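{- Let $G=(V,A)$ be a connected directed acyclic graph. Then $\mathrm{BasicLD}(G,\emptyset)$ returns an optimal layer decomposition of $G$, i.e. a layer decomposition of $G$ whose width is minimum among all layer decompositions of $G$.
   Context: All graphs are finite; a DAG is connected if its underlying undirected graph is connected. A layer decomposition of a DAG $G=(V,A)$ is a list $((T^0,S^0),\dots,(T^k,S^k))$ of pairs of subsets of $V$ such that: (D1) $(T^0,\dots,T^k)$ is an ordered partition of $V$ (into nonempty blocks); (D2) $S^i\subseteq T^i$ for every $i\in\{0,\dots,k\}$; (D3) for every $i\in\{0,\dots,k-1\}$, no two variables $X\in T^0\cup\dots\cup T^{i-1}\cup(T^i\setminus S^i)$ and $Y\in T^{i+1}\cup\dots\cup T^k$ are connected by an arrow in $G$; (D4) for every $i\in\{1,\dots,k\}$, every child in $G$ of a variable in $S^i$ belongs to $(T^i\setminus S^i)\cup S^{i-1}$, and every child of a variable in $S^0$ belongs to $T^0\setminus S^0$; (D5) for every $i\in\{0,\dots,k-1\}$, every parent in $G$ of a variable in $S^i$ belongs to $T^{i+1}$, and no variable in $S^k$ has a parent. The width of a layer decomposition is the lowest integer $w$ such that $|T^i|\le w$ for every $i\in\{0,\dots,k\}$. For $W\subseteq V$, $G[W]$ is the subgraph of $G$ induced on $W$. A partial layer decomposition (PLD) $D$ of $G$ is a layer decomposition of $G[W]$ for some $W\subseteq V$; then $\mathrm{Vars}(D)=W$. The empty list, written $\emptyset$, is the PLD with $\mathrm{Vars}(\emptyset)=\emptyset$. Let $D=((T_1^0,S_1^0),\dots,(T_1^k,S_1^k))$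 and $D'=((T_2^0,S_2^0),\dots,(T_2^j,S_2^j))$ be PLDs of $G$ with $\mathrm{Vars}(D')\subseteq\mathrm{Vars}(D)$. $D'$ is a sub-PLD of $D$ iff there is a non-negative integer $m$ such that for all $i\in\{0,\dots,j\}$: $T_2^i\subseteq T_1^{i+m}$, $S_2^i\subseteq S_1^{i+m}$ and $T_2^i\setminus S_2^i\subseteq T_1^{i+m}\setminus S_1^{i+m}$. The empty PLD is a sub-PLD of every PLD. For a PLD $D$ of $G$ and $X\in V\setminus\mathrm{Vars}(D)$, an insertion of $X$ into $D$ is a PLD $D'$ of $G$ with $\mathrm{Vars}(D')=\mathrm{Vars}(D)\cup\{X\}$ such that $D$ is a sub-PLD of $D'$. For $W\subseteq V$, a boundary variable of $W$ is a variable $X\in V\setminus W$ such that some parent or child of $X$ in $G$ belongs to $W$. Function $\mathrm{Resolution}(G,D)$: returns the special value $nil$ if there is some variable of $G$ not in $\mathrm{Vars}(D)$ that cannot be inserted into $D$ (it has no insertion into $D$); otherwise it recursively places (inserts into the current $D$) all variables of $G$ for which there is only one possible insertion, until all variables of $G$ not in $\mathrm{Vars}(D)$ have at least two possible insertions, and returns the resulting PLD (the test for a variable with no insertion is applied to the current PLD throughout this recursion). Algorithm $\mathrm{BasicLD}(G,D)$, for a DAG $G=(V,A)$ and a PLD $D$ of $G$: 1. Let $D=\mathrm{Resolution}(G,D)$. 2. If $D\neq nil$ and $\mathrm{Vars}(D)=V$, then return $D$. 3. If $D=nil$ then return $nil$. 4. If $\mathrm{Vars}(D)=\emptyset$ then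 let $X$ be any node of $G$; otherwise let $X\in V$ be any boundary variable of $\mathrm{Vars}(D)$. 5. For every insertion $D_i$ of $X$ into $D$: let $F_i=\mathrm{BasicLD}(G,D_i)$. 6. If all $F_i=nil$, then return $nil$. Otherwise, return the (non-$nil$) layer decomposition $F_i$ of minimum width (ties broken arbitrarily). -}

module Defs where

open import Level using (0ℓ)
open import Data.Nat.Base using (ℕ; zero; suc; _+_; _≤_; _<_; _⊔_; z≤n; s≤s)
open import Data.Nat.Properties using (⊔-lub; m≤n⇒m≤n⊔o; m≤n⇒m≤o⊔n; ≤-refl)
open import Data.Fin.Base using (Fin)
open import Data.Fin.Subset
  using (Subset; _∈_; _∉_; _⊆_; _∩_; _∪_; _─_; ⊤; ⊥; ⋃; ⁅_⁆; ∣_∣; Nonempty; Empty)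
open import Data.List.Base using (List; []; _∷_; length; map; foldr)
open import Data.Maybe.Base using (Maybe; just; nothing)
open import Data.Product.Base using (_×_; _,_; ∃; ∃₂; proj₁; proj₂)
open import Data.Sum.Base using (_⊎_)
open import Relation.Nullary.Negation.Core using (¬_)
open import Relation.Binary.Core using (Rel)
open import Relation.Binary.Definitions using (Decidable)
open import Relation.Binary.PropositionalEquality.Core using (_≡_; _≢_)
open import Relation.Binary.Construct.Closure.Transitive using (TransClosure)
open import Relation.Binary.Construct.Closure.Equivalence using (EqClosure)

record DAG (n : ℕ) : Set₁ where
  field
    Arrow   : Rel (Fin n) 0ℓ
    arrow?  : Decidable Arrow
    acyclic : ∀ x → ¬ TransClosure Arrow x x

open DAG public

-- Connectedness of the underlying undirected graph.
Connected : ∀ {n} → DAG n → Set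
Connected G = ∀ x y → EqClosure (Arrow G) x y

-- A list ((T⁰,S⁰),…,(Tᵏ,Sᵏ)), not yet subject to (D1)–(D5).
Layers : ℕ → Set
Layers n = List (Subset n × Subset n)

module _ {n : ℕ} where

  -- Indices beyond the last layer denote empty sets.
  layer : Layers n → ℕ → Subset n × Subset n
  layer []      _       = ⊥ , ⊥
  layer (l ∷ _) zero    = l
  layer (_ ∷ D) (suc i) = layer D i

  T S : Layers n → ℕ → Subset n
  T D i = proj₁ (layer D i)
  S D i = proj₂ (layer D i)

  Vars : Layers n → Subset n
  Vars D = ⋃ (map proj₁ D)

  width : Layers n → ℕ
  width D = foldr _⊔_ 0 (map (λ l → ∣ proj₁ l ∣) D)

  ∣T∣≤width : ∀ D i → i < length D → ∣ T D i ∣ ≤ width D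
  ∣T∣≤width (_ ∷ D) zero    _         = m≤n⇒m≤n⊔o (width D) ≤-refl
  ∣T∣≤width (l ∷ D) (suc i) (s≤s i<k) = m≤n⇒m≤o⊔n ∣ proj₁ l ∣ (∣T∣≤width D i i<k)

  width-least : ∀ D w → (∀ i → i < length D → ∣ T D i ∣ ≤ w) → width D ≤ w
  width-least []      w h = z≤n
  width-least (l ∷ D) w h =
    ⊔-lub (h 0 (s≤s z≤n)) (width-least D w λ i i<k → h (suc i) (s≤s i<k))

  -- Layer decompositions of the graph with vertex set V and arrows _⟶_.
  record IsLayerDecomposition (V : Subset n) (_⟶_ : Rel (Fin n) 0ℓ)
                              (D : Layers n) : Set where
    field
      D1-nonempty : ∀ i → i < length D → Nonempty (T D i)
      D1-disjoint : ∀ i j → i ≢ j → Empty (T D i ∩ T D j)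
      D1-covers   : Vars D ≡ V
      D2          : ∀ i → S D i ⊆ T D i
      D3          : ∀ i x y →
                    (∃ λ j → j < i × x ∈ T D j) ⊎ x ∈ T D i ─ S D i →
                    (∃ λ j → i < j × y ∈ T D j) →
                    ¬ (x ⟶ y) × ¬ (y ⟶ x)
      D4-suc      : ∀ i x y → x ∈ S D (suc i) → x ⟶ y →
                    y ∈ (T D (suc i) ─ S D (suc i)) ∪ S D i
      D4-zero     : ∀ x y → x ∈ S D 0 → x ⟶ y → y ∈ T D 0 ─ S D 0
      D5-inner    : ∀ i → suc i < length D →
                    ∀ x y → y ∈ S D i → x ⟶ y → x ∈ T D (suc i)
      D5-last     : ∀ i → suc i ≡ length D →
                    ∀ x y → y ∈ S D i → ¬ (x ⟶ y)

  -- D′ ⊑ D : D′ is a sub-PLD of D.  The empty list satisfies this vacuously.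
  _⊑_ : Rel (Layers n) 0ℓ
  D′ ⊑ D = Vars D′ ⊆ Vars D × ∃ λ m → ∀ i → i < length D′ →
    T D′ i ⊆ T D (i + m) ×
    S D′ i ⊆ S D (i + m) ×
    (T D′ i ─ S D′ i) ⊆ (T D (i + m) ─ S D (i + m))

  -- Arrows of the subgraph induced on W.
  _↾_ : Rel (Fin n) 0ℓ → Subset n → Rel (Fin n) 0ℓ
  (_⟶_ ↾ W) x y = x ∈ W × y ∈ W × x ⟶ y

module _ {n : ℕ} (G : DAG n) where

  LayerDecomposition : Layers n → Set
  LayerDecomposition = IsLayerDecomposition ⊤ (Arrow G)

  -- By D1-covers, the witness W is Vars D.
  PLD : Layers n → Set
  PLD D = ∃ λ W → IsLayerDecomposition W (Arrow G ↾ W) D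

  Optimal : Layers n → Set
  Optimal D = LayerDecomposition D ×
              (∀ D′ → LayerDecomposition D′ → width D ≤ width D′)

  Boundary : Subset n → Fin n → Set
  Boundary W x = x ∉ W × ∃ λ y → y ∈ W × (Arrow G y x ⊎ Arrow G x y)

  record Insertion (x : Fin n) (D D′ : Layers n) : Set where
    field
      fresh : x ∉ Vars D
      pld   : PLD D′
      vars  : Vars D′ ≡ Vars D ∪ ⁅ x ⁆
      sub   : D ⊑ D′

  NoInsertion : Fin n → Layers n → Set
  NoInsertion x D = ∀ D′ → ¬ Insertion x D D′

  UniqueInsertion : Fin n → Layers n → Layers n → Set
  UniqueInsertion x D D′ = Insertion x D D′ × (∀ D″ → Insertion x D D″ → D″ ≡ D′)

  ManyInsertions : Fin n → Layers n → Set
  ManyInsertions x D = ∃₂ λ D′ D″ → Insertion x D D′ × Insertion x D D″ × D′ ≢ D″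

  Blocked : Layers n → Set
  Blocked D = ∃ λ x → x ∉ Vars D × NoInsertion x D

  Settled : Layers n → Set
  Settled D = ∀ x → x ∉ Vars D → ManyInsertions x D

  ForcedStep : Rel (Layers n) 0ℓ
  ForcedStep D D′ = ¬ Blocked D × ∃ λ x → UniqueInsertion x D D′

  -- The algorithms make arbitrary choices, so they are given as big-step
  -- relations between an input and each of its possible outputs, with `nothing` for nil.
  data Resolution (D : Layers n) : Maybe (Layers n) → Set where
    blocked : Blocked D → Resolution D nothing
    forced  : ∀ {D′ r} → ForcedStep D D′ → Resolution D′ r → Resolution D r
    settled : Settled D → Resolution D (just D)

  -- The variables that may be branched on.
  Candidate : Layers n → Fin n → Set
  Candidate D x = Vars D ≡ ⊥ ⊎ (Vars D ≢ ⊥ × Boundary (Vars D) x)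

  -- F Dᵢ is the value of the recursive call on the insertion Dᵢ; F is
  -- unconstrained on lists that are not insertions.
  data BasicLD (D : Layers n) : Maybe (Layers n) → Set where
    unresolvable :
      Resolution D nothing → BasicLD D nothing
    complete : ∀ {D₁} →
      Resolution D (just D₁) → Vars D₁ ≡ ⊤ → BasicLD D (just D₁)
    all-nil : ∀ {D₁ x} (F : Layers n → Maybe (Layers n)) →
      Resolution D (just D₁) → Vars D₁ ≢ ⊤ → Candidate D₁ x →
      (∀ Dᵢ → Insertion x D₁ Dᵢ → BasicLD Dᵢ (F Dᵢ)) →
      (∀ Dᵢ → Insertion x D₁ Dᵢ → F Dᵢ ≡ nothing) →
      BasicLD D nothing
    best : ∀ {D₁ x D⋆ E} (F : Layers n → Maybe (Layers n)) →
      Resolution D (just D₁) → Vars D₁ ≢ ⊤ → Candidate D₁ x →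
      (∀ Dᵢ → Insertion x D₁ Dᵢ → BasicLD Dᵢ (F Dᵢ)) →
      Insertion x D₁ D⋆ → F D⋆ ≡ just E →
      (∀ Dᵢ Eᵢ → Insertion x D₁ Dᵢ → F Dᵢ ≡ just Eᵢ → width E ≤ width Eᵢ) →
      BasicLD D (just E)

  -- Termination under every sequence of choices: no execution runs forever,
  -- and none gets stuck for want of an applicable case or a candidate.
  data ResolutionTerminates (D : Layers n) : Set where
    terminates :
      Blocked D ⊎ Settled D ⊎ ∃ (ForcedStep D) →
      (∀ D′ → ForcedStep D D′ → ResolutionTerminates D′) →
      ResolutionTerminates D

  data BasicLDTerminates (D : Layers n) : Set where
    terminates :
      ResolutionTerminates D →
      (∀ D₁ → Resolution D (just D₁) → Vars D₁ ≢ ⊤ →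
        ∃ (Candidate D₁) ×
        (∀ x Dᵢ → Candidate D₁ x → Insertion x D₁ Dᵢ → BasicLDTerminates Dᵢ)) →
      BasicLDTerminates D

module Submission where

-- Fix a layer decomposition E of G; the run starts from ∅ ⊑ E, and it suffices to follow one
-- branch of the recursion on which D ⊑ E persists: it ends in a decomposition no wider than E.
-- Arrows of G only join equal or consecutive layers of E, and the layers of D are nonempty, so
-- D occupies consecutive layers of E, and cutting E down to Vars D and a boundary variable x is
-- again a PLD: an insertion of x into D below E.  If the insertion of x is forced, this is the one.
-- A variable with no neighbour in Vars D can be put in the first layer of D both inside and
-- outside S⁰, so it is never forced and never blocks.  The run does not return nil because
-- ((V , ∅)) is a layer decomposition.  Runs terminate because insertions enlarge Vars D, and they
-- exist because a PLD has at most n layers, so that all insertions can be searched.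

open import Defs
open import Data.Nat.Base using (ℕ; zero; suc; _+_; _∸_; _≤_; _<_; z≤n; s≤s; s≤s⁻¹)
open import Data.Nat.Properties
open import Data.Nat.Induction using (<-wellFounded)
open import Data.Bool.Properties using () renaming (_≟_ to _≟ᵇ_)
open import Data.Fin.Base using (Fin; zero; suc; toℕ)
open import Data.Fin.Properties using (any?; all?; ∀-cons; injective⇒≤; toℕ<n; toℕ-injective)
open import Data.Fin.Subset
open import Data.Fin.Subset.Properties
open import Data.Fin.Subset.Induction using (⊃-wellFounded)
open import Data.List.Base using ([]; _∷_; length; drop; applyUpTo)
open import Data.List.Properties using (length-applyUpTo) renaming (≡-dec to List-≡-dec)
open import Data.Maybe.Base using (Maybe; just; nothing)
open import Data.Product.Base using (_×_; _,_; ∃; ∃₂; proj₁; proj₂; map₂)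
open import Data.Product.Properties using () renaming (≡-dec to ×-≡-dec)
open import Data.Sum.Base using (_⊎_; inj₁; inj₂; [_,_]′)
open import Data.Unit.Base using (tt)
open import Data.Vec.Base using (_∷_; there)
open import Data.Vec.Properties using () renaming (≡-dec to Vec-≡-dec)
open import Function.Base using (_∘_; case_of_)
open import Induction.WellFounded using (Acc; acc)
open import Relation.Binary.Core using (Rel)
open import Relation.Binary.Definitions using (DecidableEquality) renaming (Decidable to Decidable₂)
open import Relation.Binary.Construct.Closure.Equivalence using (EqClosure)
open import Relation.Binary.Construct.Closure.ReflexiveTransitive using (ε; _◅_)
open import Relation.Binary.Construct.Closure.Symmetric using (fwd; bwd)
open import Relation.Binary.Construct.Closure.Transitive using ([_])
open import Relation.Binary.PropositionalEquality.Core using (_≡_; _≢_; refl; sym; trans; cong; subst)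
open import Relation.Nullary.Decidable using (Dec; yes; no; map′; _×-dec_; _⊎-dec_; _→-dec_; ¬?; decidable-stable)
open import Relation.Nullary.Negation using (¬_; contradiction)
open import Relation.Unary using (Pred; Decidable)
open import Level using (0ℓ)

-- Set difference, and searches over bounded or finite domains.

x∈p─q⇒x∉q : ∀ {n} {x : Fin n} (p q : Subset n) → x ∈ p ─ q → x ∉ q
x∈p─q⇒x∉q (_ ∷ p) (inside  ∷ q) (there a) (there b) = x∈p─q⇒x∉q p q a b
x∈p─q⇒x∉q (_ ∷ p) (outside ∷ q) (there a) (there b) = x∈p─q⇒x∉q p q a b

-- Layers past the end of a list are `⊥`, so the layer conditions hold there vacuously and a
-- quantifier over all indices reduces to `k` tests.
all-eventually? : ∀ {P : Pred ℕ 0ℓ} k → Decidable P → (∀ i → k ≤ i → P i) → Dec (∀ i → P i)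
all-eventually? {P} k P? tail =
  map′ (λ f i → [ (λ i<k → f i<k) , tail i ]′ (<-≤-connex i k)) (λ f {i} _ → f i) (allUpTo? P? k)

any-below? : ∀ {P : Pred ℕ 0ℓ} k → Decidable P → (∀ {i} → P i → i < k) → Dec (∃ P)
any-below? k P? bound = map′ (λ (i , _ , p) → i , p) (λ (i , p) → i , bound p , p) (anyUpTo? P? k)

-- A choice between the alternatives at each point is enough, which fits classifications that prove
-- one side without deciding the other.
Fin-search : ∀ {n} {A B : Fin n → Set} → (∀ x → A x ⊎ B x) → ∃ A ⊎ (∀ x → B x)
Fin-search {zero}  f = inj₂ λ ()
Fin-search {suc n} f with f zero | Fin-search (f ∘ suc)
... | inj₁ a | _            = inj₁ (zero , a)
... | inj₂ b | inj₁ (x , a) = inj₁ (suc x , a)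
... | inj₂ b | inj₂ bs      = inj₂ (∀-cons b bs)

any-just? : ∀ {A : Set} {P : Pred A 0ℓ} → Decidable P → ∀ m → Dec (∃ λ a → m ≡ just a × P a)
any-just? P? nothing  = no λ ()
any-just? P? (just a) = map′ (λ p → a , refl , p) (λ { (_ , refl , p) → p }) (P? a)

-- Lists of layers: membership, equality, bounded search.

module _ {n : ℕ} where

  ∈T⇒< : ∀ (D : Layers n) i {x} → x ∈ T D i → i < length D
  ∈T⇒< []      i       x∈T = contradiction x∈T ∉⊥
  ∈T⇒< (_ ∷ D) zero    x∈T = s≤s z≤n
  ∈T⇒< (_ ∷ D) (suc i) x∈T = s≤s (∈T⇒< D i x∈T)

  ∈S⇒< : ∀ (D : Layers n) i {x} → x ∈ S D i → i < length D
  ∈S⇒< []      i       x∈S = contradiction x∈S ∉⊥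
  ∈S⇒< (_ ∷ D) zero    x∈S = s≤s z≤n
  ∈S⇒< (_ ∷ D) (suc i) x∈S = s≤s (∈S⇒< D i x∈S)

  layer-beyond : ∀ (D : Layers n) i → length D ≤ i → layer D i ≡ (⊥ , ⊥)
  layer-beyond []      i       _         = refl
  layer-beyond (_ ∷ D) (suc i) (s≤s k≤i) = layer-beyond D i k≤i

  ∈Vars⁺ : ∀ (D : Layers n) i {x} → x ∈ T D i → x ∈ Vars D
  ∈Vars⁺ []            i       x∈T = contradiction x∈T ∉⊥
  ∈Vars⁺ ((t , _) ∷ D) zero    x∈T = p⊆p∪q (Vars D) x∈T
  ∈Vars⁺ ((t , _) ∷ D) (suc i) x∈T = q⊆p∪q t (Vars D) (∈Vars⁺ D i x∈T)

  ∈Vars⁻ : ∀ (D : Layers n) {x} → x ∈ Vars D → ∃ λ i → x ∈ T D i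
  ∈Vars⁻ []            x∈⊥ = contradiction x∈⊥ ∉⊥
  ∈Vars⁻ ((t , _) ∷ D) x∈V with x∈p∪q⁻ t (Vars D) x∈V
  ... | inj₁ x∈t = zero , x∈t
  ... | inj₂ x∈D with i , x∈T ← ∈Vars⁻ D x∈D = suc i , x∈T

  layer-applyUpTo : ∀ (f : ℕ → Subset n × Subset n) k {i} → i < k → layer (applyUpTo f k) i ≡ f i
  layer-applyUpTo f (suc k) {zero}  _         = refl
  layer-applyUpTo f (suc k) {suc i} (s≤s i<k) = layer-applyUpTo (f ∘ suc) k i<k

  layer-drop : ∀ (D : Layers n) i → layer (drop 1 D) i ≡ layer D (suc i)
  layer-drop []      i = refl
  layer-drop (_ ∷ D) i = refl

  length-drop : ∀ (D : Layers n) {i} → i < length D → suc (length (drop 1 D)) ≡ length D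
  length-drop (_ ∷ D) _ = refl

  suc<length : ∀ (D : Layers n) {i} → suc i < suc (length (drop 1 D)) → suc i < length D
  suc<length []      (s≤s ())
  suc<length (_ ∷ D) lt = lt

  -- The index is unrestricted because `⊑` compares layer `i` with layer `i + m`, which carries no
  -- bound; past the end the layer is empty.
  ∣T∣≤width′ : ∀ (D : Layers n) i → ∣ T D i ∣ ≤ width D
  ∣T∣≤width′ D i with i <? length D
  ... | yes i<k = ∣T∣≤width D i i<k
  ... | no  i≮k rewrite layer-beyond D i (≮⇒≥ i≮k) | ∣⊥∣≡0 n = z≤n

  _≟ˢ_ : DecidableEquality (Subset n)
  _≟ˢ_ = Vec-≡-dec _≟ᵇ_

  _≟ˡ_ : DecidableEquality (Layers n)
  _≟ˡ_ = List-≡-dec (×-≡-dec _≟ˢ_ _≟ˢ_)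

  -- Each entry ranges over finitely many pairs of subsets, so a bound on the length makes the
  -- search finite.
  any-Layers? : ∀ {P : Pred (Layers n) 0ℓ} k → Decidable P → (∀ {D} → P D → length D ≤ k) → Dec (∃ P)
  any-Layers? k P? bound =
    map′ (λ (D , _ , p) → D , p) (λ (D , p) → D , bound p , p) (bounded k P?)
    where
    bounded : ∀ {P : Pred (Layers n) 0ℓ} k → Decidable P → Dec (∃ λ D → length D ≤ k × P D)
    bounded zero    P? = map′ (λ p → [] , z≤n , p) (λ { ([] , _ , p) → p }) (P? [])
    bounded (suc k) P? = map′
      (λ { (inj₁ p)                     → [] , z≤n , p
         ; (inj₂ (t , s , D , D≤k , p)) → (t , s) ∷ D , s≤s D≤k , p })
      (λ { ([] , _ , p)                    → inj₁ p
         ; ((t , s) ∷ D , s≤s D≤k , p) → inj₂ (t , s , D , D≤k , p) })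
      (P? [] ⊎-dec anySubset? λ t → anySubset? λ s → bounded k λ D → P? ((t , s) ∷ D))

  -- Disjointness of layers and arrows between them.

  module _ {V : Subset n} {_⟶_ : Rel (Fin n) 0ℓ} {D : Layers n}
           (ld : IsLayerDecomposition V _⟶_ D) where
    open IsLayerDecomposition ld

    same-layer : ∀ {i j x} → x ∈ T D i → x ∈ T D j → i ≡ j
    same-layer {i} {j} x∈Ti x∈Tj = decidable-stable (i ≟ j) λ i≢j →
      D1-disjoint i j i≢j (_ , x∈p∩q⁺ (x∈Ti , x∈Tj))

    -- One element chosen from each layer gives an injection of the layer indices into the
    -- variables, as the layers are disjoint.
    length≤n : length D ≤ n
    length≤n = injective⇒≤ {f = λ i → proj₁ (D1-nonempty (toℕ i) (toℕ<n i))} λ {i} {j} eq →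
      toℕ-injective (same-layer (proj₂ (D1-nonempty (toℕ i) (toℕ<n i)))
        (subst (_∈ T D (toℕ j)) (sym eq) (proj₂ (D1-nonempty (toℕ j) (toℕ<n j)))))

    -- (D3) is applied at the intermediate layer `suc i`: `x` lies strictly below it and `y`
    -- strictly above.
    D3-far : ∀ {i j x y} → suc i < j → x ∈ T D i → y ∈ T D j → ¬ (x ⟶ y) × ¬ (y ⟶ x)
    D3-far {i} {j} i+1<j x∈Ti y∈Tj =
      D3 (suc i) _ _ (inj₁ (i , ≤-refl , x∈Ti)) (j , i+1<j , y∈Tj)

    adjacent-layers : ∀ {i j x y} → x ∈ T D i → y ∈ T D j → (x ⟶ y) ⊎ (y ⟶ x) → j ≤ suc i × i ≤ suc j
    adjacent-layers x∈Ti y∈Tj xy =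
        ≮⇒≥ (λ lt → [ proj₁ (D3-far lt x∈Ti y∈Tj) , proj₂ (D3-far lt x∈Ti y∈Tj) ]′ xy)
      , ≮⇒≥ (λ lt → [ proj₂ (D3-far lt y∈Tj x∈Ti) , proj₁ (D3-far lt y∈Tj x∈Ti) ]′ xy)

  -- Decidability of layer decompositions and of `⊑`.

  isLayerDecomposition? : ∀ V {_⟶_ : Rel (Fin n) 0ℓ} → Decidable₂ _⟶_ →
                          ∀ D → Dec (IsLayerDecomposition V _⟶_ D)
  isLayerDecomposition? V {_⟶_} _⟶?_ D = map′
    (λ { (ne , dj , cv , d2 , d3 , d4 , d4₀ , d5 , d5ₖ) → record
      { D1-nonempty = ne ; D1-disjoint = dj ; D1-covers = cv ; D2 = d2 ; D3 = d3
      ; D4-suc = d4 ; D4-zero = d4₀ ; D5-inner = d5 ; D5-last = d5ₖ } })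
    (λ ld → let open IsLayerDecomposition ld in
      D1-nonempty , D1-disjoint , D1-covers , D2 , D3 , D4-suc , D4-zero , D5-inner , D5-last)
    (nonempty-layers? ×-dec disjoint? ×-dec (Vars D ≟ˢ V) ×-dec D2? ×-dec D3? ×-dec
     D4-suc? ×-dec D4-zero? ×-dec D5-inner? ×-dec D5-last?)
    where
    k = length D

    nonempty-layers? : Dec (∀ i → i < k → Nonempty (T D i))
    nonempty-layers? = all-eventually? k (λ i → (i <? k) →-dec nonempty? (T D i))
      (λ i k≤i i<k → contradiction i<k (≤⇒≯ k≤i))

    disjoint? : Dec (∀ i j → i ≢ j → Empty (T D i ∩ T D j))
    disjoint? = all-eventually? k
      (λ i → all-eventually? k (λ j → ¬? (i ≟ j) →-dec ¬? (nonempty? (T D i ∩ T D j)))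
        λ j k≤j _ (x , x∈) → ≤⇒≯ k≤j (∈T⇒< D j (proj₂ (x∈p∩q⁻ (T D i) _ x∈))))
      (λ i k≤i j _ (x , x∈) → ≤⇒≯ k≤i (∈T⇒< D i (proj₁ (x∈p∩q⁻ (T D i) _ x∈))))

    D2? : Dec (∀ i → S D i ⊆ T D i)
    D2? = all-eventually? k (λ i → S D i ⊆? T D i)
      (λ i k≤i x∈S → contradiction (∈S⇒< D i x∈S) (≤⇒≯ k≤i))

    D3? : Dec (∀ i x y → (∃ λ j → j < i × x ∈ T D j) ⊎ x ∈ T D i ─ S D i →
               (∃ λ j → i < j × y ∈ T D j) → ¬ (x ⟶ y) × ¬ (y ⟶ x))
    D3? = all-eventually? k
      (λ i → all? λ x → all? λ y →
        (any-below? k (λ j → (j <? i) ×-dec (x ∈? T D j)) (λ {j} (_ , x∈T) → ∈T⇒< D j x∈T)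
           ⊎-dec (x ∈? (T D i ─ S D i))) →-dec
        any-below? k (λ j → (i <? j) ×-dec (y ∈? T D j)) (λ {j} (_ , y∈T) → ∈T⇒< D j y∈T) →-dec
        (¬? (x ⟶? y) ×-dec ¬? (y ⟶? x)))
      (λ i k≤i x y _ (j , i<j , y∈T) → contradiction (<-trans i<j (∈T⇒< D j y∈T)) (≤⇒≯ k≤i))

    D4-suc? : Dec (∀ i x y → x ∈ S D (suc i) → x ⟶ y →
                   y ∈ (T D (suc i) ─ S D (suc i)) ∪ S D i)
    D4-suc? = all-eventually? k
      (λ i → all? λ x → all? λ y → (x ∈? S D (suc i)) →-dec (x ⟶? y) →-dec
        (y ∈? ((T D (suc i) ─ S D (suc i)) ∪ S D i)))
      (λ i k≤i x y x∈S _ → contradiction (∈S⇒< D (suc i) x∈S) (≤⇒≯ (m≤n⇒m≤1+n k≤i)))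

    D4-zero? : Dec (∀ x y → x ∈ S D 0 → x ⟶ y → y ∈ T D 0 ─ S D 0)
    D4-zero? = all? λ x → all? λ y → (x ∈? S D 0) →-dec (x ⟶? y) →-dec (y ∈? (T D 0 ─ S D 0))

    D5-inner? : Dec (∀ i → suc i < k → ∀ x y → y ∈ S D i → x ⟶ y → x ∈ T D (suc i))
    D5-inner? = all-eventually? k
      (λ i → (suc i <? k) →-dec all? λ x → all? λ y →
        (y ∈? S D i) →-dec (x ⟶? y) →-dec (x ∈? T D (suc i)))
      (λ i k≤i i+1<k → contradiction i+1<k (≤⇒≯ (m≤n⇒m≤1+n k≤i)))

    D5-last? : Dec (∀ i → suc i ≡ k → ∀ x y → y ∈ S D i → ¬ (x ⟶ y))
    D5-last? = all-eventually? k
      (λ i → (suc i ≟ k) →-dec all? λ x → all? λ y → (y ∈? S D i) →-dec ¬? (x ⟶? y))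
      (λ i k≤i i+1≡k → contradiction (≤-reflexive i+1≡k) (≤⇒≯ k≤i))

  _⊑?_ : Decidable₂ (_⊑_ {n})
  D′ ⊑? D = (Vars D′ ⊆? Vars D) ×-dec map′ (λ (m , _ , h) → m , h) cap
    (anyUpTo? (λ m → all-eventually? (length D′)
      (λ i → (i <? length D′) →-dec fits? i (layer D (i + m)))
      (λ i k≤i i<k → contradiction i<k (≤⇒≯ k≤i))) (suc (length D)))
    where
    Fits : ℕ → Subset n × Subset n → Set
    Fits i (t , s) = T D′ i ⊆ t × S D′ i ⊆ s × (T D′ i ─ S D′ i) ⊆ (t ─ s)
    fits? : ∀ i l → Dec (Fits i l)
    fits? i (t , s) = (T D′ i ⊆? t) ×-dec (S D′ i ⊆? s) ×-dec ((T D′ i ─ S D′ i) ⊆? (t ─ s))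
    cap : (∃ λ m → ∀ i → i < length D′ → Fits i (layer D (i + m))) →
          ∃ λ m → m < suc (length D) × ∀ i → i < length D′ → Fits i (layer D (i + m))
    cap (m , h) with ≤-total m (length D)
    ... | inj₁ m≤k = m , s≤s m≤k , h
    -- A shift of at least `length D` reads only empty layers, so it can be replaced by `length D`
    -- itself.
    ... | inj₂ k≤m = length D , ≤-refl , λ i i<k → subst (Fits i)
      (trans (layer-beyond D (i + m) (≤-trans k≤m (m≤n+m m i)))
             (sym (layer-beyond D (i + length D) (m≤n+m (length D) i))))
      (h i i<k)

  ∅⊑ : ∀ (D : Layers n) → [] ⊑ D
  ∅⊑ D = (λ x∈ → contradiction x∈ ∉⊥) , 0 , λ _ ()

  ⊑⇒width≤ : ∀ (D D′ : Layers n) → D ⊑ D′ → width D ≤ width D′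
  ⊑⇒width≤ D D′ (_ , m , h) = width-least D _ λ i i<k →
    ≤-trans (p⊆q⇒∣p∣≤∣q∣ (proj₁ (h i i<k))) (∣T∣≤width′ D′ (i + m))

-- PLDs and layer decompositions of a fixed graph.

module _ {n : ℕ} (G : DAG n) where

  PLD⇒induced : ∀ {D} → PLD G D → IsLayerDecomposition (Vars D) (Arrow G ↾ Vars D) D
  PLD⇒induced {D} (W , ld) =
    subst (λ W → IsLayerDecomposition W (Arrow G ↾ W) D) (sym (IsLayerDecomposition.D1-covers ld)) ld

  PLD-∅ : PLD G []
  PLD-∅ = ⊥ , record
    { D1-nonempty = λ _ ()
    ; D1-disjoint = λ { _ _ _ (_ , x∈) → ∉⊥ (proj₁ (x∈p∩q⁻ ⊥ ⊥ x∈)) }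
    ; D1-covers   = refl
    ; D2          = λ _ x∈ → x∈
    ; D3          = λ _ _ _ _ (_ , _ , y∈) → contradiction y∈ ∉⊥
    ; D4-suc      = λ _ _ _ x∈ → contradiction x∈ ∉⊥
    ; D4-zero     = λ _ _ x∈ → contradiction x∈ ∉⊥
    ; D5-inner    = λ _ ()
    ; D5-last     = λ _ ()
    }

  PLD-full : ∀ {D} → PLD G D → Vars D ≡ ⊤ → LayerDecomposition G D
  PLD-full {D} pld full = record
    { D1-nonempty = D1-nonempty
    ; D1-disjoint = D1-disjoint
    ; D1-covers   = full
    ; D2          = D2
    ; D3          = λ i x y x∈ y∈ →
        proj₁ (D3 i x y x∈ y∈) ∘ induced , proj₂ (D3 i x y x∈ y∈) ∘ induced
    ; D4-suc      = λ i x y x∈S a → D4-suc i x y x∈S (induced a)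
    ; D4-zero     = λ x y x∈S a → D4-zero x y x∈S (induced a)
    ; D5-inner    = λ i i+1<k x y y∈S a → D5-inner i i+1<k x y y∈S (induced a)
    ; D5-last     = λ i i+1≡k x y y∈S a → D5-last i i+1≡k x y y∈S (induced a)
    }
    where
    open IsLayerDecomposition (PLD⇒induced pld)
    ∈Vars : ∀ {x} → x ∈ Vars D
    ∈Vars = subst (_ ∈_) (sym full) ∈⊤
    induced : ∀ {x y} → Arrow G x y → (Arrow G ↾ Vars D) x y
    induced a = ∈Vars , ∈Vars , a

  -- Windows: consecutive layers of `E`, restricted to a set of variables.

  module _ {E : Layers n} (ld : LayerDecomposition G E) where
    open IsLayerDecomposition ld

    ∈layer : ∀ x → ∃ λ i → x ∈ T E i
    ∈layer x = ∈Vars⁻ E (subst (x ∈_) (sym D1-covers) ∈⊤)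

    -- `meets` keeps the blocks nonempty. `within` confines `W` to the layers `m`, ..., `m + k − 1`
    -- of `E`, which settles the conditions at both ends of the window.
    module Window (W : Subset n) (m k : ℕ)
                  (meets : ∀ i → i < k → ∃ λ x → x ∈ W × x ∈ T E (i + m))
                  (within : ∀ {x} → x ∈ W → ∃ λ i → i < k × x ∈ T E (i + m)) where

      cut : ℕ → Subset n × Subset n
      cut i = T E (i + m) ∩ W , S E (i + m) ∩ W

      window : Layers n
      window = applyUpTo cut k

      length-window : length window ≡ k
      length-window = length-applyUpTo cut k

      index< : ∀ {i x} → x ∈ W → x ∈ T E (i + m) → i < k
      index< {i} x∈W x∈Ti with j , j<k , x∈Tj ← within x∈W =
        subst (_< k) (+-cancelʳ-≡ m j i (same-layer ld x∈Tj x∈Ti)) j<k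

      T⁺ : ∀ {i x} → x ∈ W → x ∈ T E (i + m) → x ∈ T window i
      T⁺ {x = x} x∈W x∈T = subst (λ l → x ∈ proj₁ l)
        (sym (layer-applyUpTo cut k (index< x∈W x∈T))) (x∈p∩q⁺ (x∈T , x∈W))

      S⁺ : ∀ {i x} → x ∈ W → x ∈ S E (i + m) → x ∈ S window i
      S⁺ {i} {x} x∈W x∈S = subst (λ l → x ∈ proj₂ l)
        (sym (layer-applyUpTo cut k (index< x∈W (D2 (i + m) x∈S)))) (x∈p∩q⁺ (x∈S , x∈W))

      T⁻ : ∀ i {x} → x ∈ T window i → x ∈ T E (i + m) × x ∈ W
      T⁻ i {x} x∈T = x∈p∩q⁻ _ W (subst (λ l → x ∈ proj₁ l)
        (layer-applyUpTo cut k (subst (i <_) length-window (∈T⇒< window i x∈T))) x∈T)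

      S⁻ : ∀ i {x} → x ∈ S window i → x ∈ S E (i + m) × x ∈ W
      S⁻ i {x} x∈S = x∈p∩q⁻ _ W (subst (λ l → x ∈ proj₂ l)
        (layer-applyUpTo cut k (subst (i <_) length-window (∈S⇒< window i x∈S))) x∈S)

      T─S⁺ : ∀ {i x} → x ∈ W → x ∈ T E (i + m) ─ S E (i + m) → x ∈ T window i ─ S window i
      T─S⁺ {i} x∈W x∈ = x∈p∧x∉q⇒x∈p─q (T⁺ x∈W (p─q⊆p _ _ x∈))
        (λ x∈S → x∈p─q⇒x∉q (T E (i + m)) _ x∈ (proj₁ (S⁻ i x∈S)))

      T─S⁻ : ∀ i {x} → x ∈ T window i ─ S window i → x ∈ T E (i + m) ─ S E (i + m)
      T─S⁻ i x∈ with x∈T , x∈W ← T⁻ i (p─q⊆p (T window i) _ x∈) =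
        x∈p∧x∉q⇒x∈p─q x∈T (λ x∈S → x∈p─q⇒x∉q (T window i) _ x∈ (S⁺ x∈W x∈S))

      Vars-window : Vars window ≡ W
      Vars-window = ⊆-antisym
        (λ x∈V → case ∈Vars⁻ window x∈V of λ (i , x∈T) → proj₂ (T⁻ i x∈T))
        (λ x∈W → case within x∈W of λ (i , _ , x∈T) → ∈Vars⁺ window i (T⁺ x∈W x∈T))

      window-⊑ : window ⊑ E
      window-⊑ = (λ _ → subst (_ ∈_) (sym D1-covers) ∈⊤) , m , λ i _ →
        proj₁ ∘ T⁻ i , proj₁ ∘ S⁻ i , T─S⁻ i

      window-isLayerDecomposition : IsLayerDecomposition W (Arrow G ↾ W) window
      window-isLayerDecomposition = record
        { D1-nonempty = λ i i<k → case meets i (subst (i <_) length-window i<k) of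
            λ (x , x∈W , x∈T) → x , T⁺ x∈W x∈T
        ; D1-disjoint = λ i j i≢j (x , x∈) → case x∈p∩q⁻ (T window i) _ x∈ of
            λ (x∈Ti , x∈Tj) → i≢j (+-cancelʳ-≡ m i j
              (same-layer ld (proj₁ (T⁻ i x∈Ti)) (proj₁ (T⁻ j x∈Tj))))
        ; D1-covers = Vars-window
        ; D2 = λ i x∈S → case S⁻ i x∈S of λ (x∈S , x∈W) → T⁺ x∈W (D2 (i + m) x∈S)
        ; D3 = λ i x y x∈ (j , i<j , y∈T) →
            case D3 (i + m) x y
              (case x∈ of λ { (inj₁ (j , j<i , x∈T)) → inj₁ (j + m , +-monoˡ-< m j<i , proj₁ (T⁻ j x∈T))
                            ; (inj₂ x∈T─S)           → inj₂ (T─S⁻ i x∈T─S) })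
              (j + m , +-monoˡ-< m i<j , proj₁ (T⁻ j y∈T))
            of λ (¬xy , ¬yx) → (λ (_ , _ , a) → ¬xy a) , (λ (_ , _ , a) → ¬yx a)
        ; D4-suc = λ i x y x∈S (_ , y∈W , a) →
            case x∈p∪q⁻ _ _ (D4-suc (i + m) x y (proj₁ (S⁻ (suc i) x∈S)) a) of
            λ { (inj₁ y∈T─S) → x∈p∪q⁺ (inj₁ (T─S⁺ y∈W y∈T─S))
              ; (inj₂ y∈S)   → x∈p∪q⁺ (inj₂ (S⁺ y∈W y∈S)) }
        ; D4-zero = λ x y x∈S (_ , y∈W , a) → T─S⁺ y∈W (child x y m refl (proj₁ (S⁻ 0 x∈S)) y∈W a)
        ; D5-inner = λ i i+1<k x y y∈S (x∈W , _ , a) → T⁺ x∈W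
            (D5-inner (i + m)
              -- The next layer of the window contains an element, so layer `suc i + m` exists in
              -- `E`.
              (case meets (suc i) (subst (suc i <_) length-window i+1<k) of
                λ (z , _ , z∈T) → ∈T⇒< E (suc i + m) z∈T)
              x y (proj₁ (S⁻ i y∈S)) a)
        -- If `E` continues past the window, a parent of `y` would lie in the layer just after it,
        -- where `W` has no element; otherwise (D5) for the last layer of `E` applies.
        ; D5-last = λ i i+1≡k x y y∈S (x∈W , _ , a) → let y∈SE = proj₁ (S⁻ i y∈S) in
            case m≤n⇒m<n∨m≡n (∈S⇒< E (i + m) y∈SE) of
            λ { (inj₁ lt) → <⇒≢ (index< x∈W (D5-inner (i + m) lt x y y∈SE a))
                                 (trans i+1≡k length-window)
              ; (inj₂ eq) → D5-last (i + m) eq x y y∈SE a }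
        }
        where
        -- The first layer of the window need not be layer 0 of `E`. If it is not, (D4) also allows
        -- a child in the S part of the layer below, which `within` excludes for members of `W`. The
        -- layer is a variable `j` with an equation so that a case split is possible.
        child : ∀ x y j → j ≡ m → x ∈ S E j → y ∈ W → Arrow G x y → y ∈ T E j ─ S E j
        child x y zero    _    x∈S y∈W a = D4-zero x y x∈S a
        child x y (suc j) refl x∈S y∈W a with x∈p∪q⁻ _ _ (D4-suc j x y x∈S a)
        ... | inj₁ y∈T─S = y∈T─S
        ... | inj₂ y∈S with i , _ , y∈T ← within y∈W =
          contradiction (same-layer ld (D2 j y∈S) y∈T) (<⇒≢ (m≤n+m (suc j) i))

  -- Insertions that stay below `E`.

  ExtendsTo : Layers n → Fin n → Layers n → Set
  ExtendsTo D x E = ∃ λ D′ → Insertion G x D D′ × D′ ⊑ E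

  module _ {D E : Layers n} (pld : PLD G D) (ld : LayerDecomposition G E) where
    private
      module D = IsLayerDecomposition (PLD⇒induced pld)

    -- D starts in layer s + m of E, x lies in layer j + m, and the extension is cut out of the
    -- layers m, …, m + k − 1 of E.
    extend-window : ∀ {x} → x ∉ Vars D → ∀ s m j k →
      (∀ i → i < length D → T D i ⊆ T E (i + (s + m)) × S D i ⊆ S E (i + (s + m)) ×
                            (T D i ─ S D i) ⊆ (T E (i + (s + m)) ─ S E (i + (s + m)))) →
      x ∈ T E (j + m) → j < k → length D + s ≤ k →
      (∀ i → i < k → i ≡ j ⊎ ∃ λ i₀ → i₀ < length D × i ≡ i₀ + s) →
      ExtendsTo D x E
    extend-window {x} x∉D s m j k embed x∈Tj j<k D+s≤k hit = window , record
      { fresh = x∉D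
      ; pld   = W , window-isLayerDecomposition
      ; vars  = Vars-window
      ; sub   = (λ y∈D → subst (_ ∈_) (sym Vars-window) (D⊆W y∈D)) , s , λ i i<k →
          let T⊆ , S⊆ , T─S⊆ = embed′ i i<k in
          (λ y∈T → T⁺ (D⊆W (∈Vars⁺ D i y∈T)) (T⊆ y∈T)) ,
          (λ y∈S → S⁺ (D⊆W (∈Vars⁺ D i (D.D2 i y∈S))) (S⊆ y∈S)) ,
          (λ y∈ → T─S⁺ (D⊆W (∈Vars⁺ D i (p─q⊆p (T D i) _ y∈))) (T─S⊆ y∈))
      } , window-⊑
      where
      W = Vars D ∪ ⁅ x ⁆
      D⊆W : Vars D ⊆ W
      D⊆W = p⊆p∪q ⁅ x ⁆
      x∈W : x ∈ W
      x∈W = q⊆p∪q (Vars D) ⁅ x ⁆ (x∈⁅x⁆ x)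
      embed′ : ∀ i → i < length D →
        T D i ⊆ T E (i + s + m) × S D i ⊆ S E (i + s + m) ×
        (T D i ─ S D i) ⊆ (T E (i + s + m) ─ S E (i + s + m))
      embed′ i i<k = subst
        (λ e → T D i ⊆ T E e × S D i ⊆ S E e × (T D i ─ S D i) ⊆ (T E e ─ S E e))
        (sym (+-assoc i s m)) (embed i i<k)
      meets : ∀ i → i < k → ∃ λ y → y ∈ W × y ∈ T E (i + m)
      meets i i<k with hit i i<k
      ... | inj₁ refl = x , x∈W , x∈Tj
      ... | inj₂ (i₀ , i₀<D , refl) with y , y∈T ← D.D1-nonempty i₀ i₀<D =
        y , D⊆W (∈Vars⁺ D i₀ y∈T) , proj₁ (embed′ i₀ i₀<D) y∈T
      within : ∀ {y} → y ∈ W → ∃ λ i → i < k × y ∈ T E (i + m)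
      within y∈W with x∈p∪q⁻ (Vars D) ⁅ x ⁆ y∈W
      ... | inj₂ y∈x rewrite x∈⁅y⁆⇒x≡y x y∈x = j , j<k , x∈Tj
      ... | inj₁ y∈D with i , y∈T ← ∈Vars⁻ D y∈D =
        i + s , <-≤-trans (+-monoˡ-< s (∈T⇒< D i y∈T)) D+s≤k , proj₁ (embed′ i (∈T⇒< D i y∈T)) y∈T
      open Window ld W m k meets within

    -- Nonempty blocks force a PLD without variables to have no layers, so the window is the single
    -- layer of `E` that contains `x`.
    extend-⊥ : Vars D ≡ ⊥ → ∀ x → ExtendsTo D x E
    extend-⊥ empty x with j , x∈T ← ∈layer ld x =
      extend-window (λ x∈D → no-var x∈D) 0 j 0 1
        (λ i i<k → contradiction i<k (no-layer i)) x∈T ≤-refl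
        (subst (_≤ 1) (sym (+-identityʳ _)) (≤-trans (≮⇒≥ (no-layer 0)) z≤n))
        (λ { zero _ → inj₁ refl ; (suc _) (s≤s ()) })
      where
      no-var : ∀ {y} → y ∉ Vars D
      no-var y∈D = ∉⊥ (subst (_ ∈_) empty y∈D)
      no-layer : ∀ i → ¬ (i < length D)
      no-layer i i<k with y , y∈T ← D.D1-nonempty i i<k = no-var (∈Vars⁺ D i y∈T)

    -- The neighbour `y` sits in layer `i + d` of `E`, so `x` is at most one layer away: inside the
    -- range of layers occupied by `D`, or directly next to one of its ends.
    extend-boundary : D ⊑ E → ∀ x → Boundary G (Vars D) x → ExtendsTo D x E
    extend-boundary (_ , d , embed) x (x∉D , y , y∈D , adj)
      with j , x∈T ← ∈layer ld x | i , y∈T ← ∈Vars⁻ D y∈D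
      with i<k ← ∈T⇒< D i y∈T
      with j≤ , ≤j ← adjacent-layers ld (proj₁ (embed i i<k) y∈T) x∈T adj
      with <-≤-connex j d
    -- From `d ≤ i + d ≤ suc j` and `j < d` follows `suc j ≡ d`: the window starts one layer
    -- earlier, and `D` sits in it with shift 1.
    ... | inj₁ j<d = extend-window x∉D 1 j 0 (suc (length D))
      (subst (λ e → ∀ i → i < length D → T D i ⊆ T E (i + e) × S D i ⊆ S E (i + e) ×
                            (T D i ─ S D i) ⊆ (T E (i + e) ─ S E (i + e)))
             (≤-antisym (≤-trans (m≤n+m d i) ≤j) j<d) embed)
      x∈T (s≤s z≤n) (≤-reflexive (+-comm (length D) 1))
      (λ { zero _ → inj₁ refl ; (suc i) (s≤s i<k) → inj₂ (i , i<k , +-comm 1 i) })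
    ... | inj₂ d≤j with <-≤-connex (j ∸ d) (length D)
    ...   | inj₁ j-d<D = extend-window x∉D 0 d (j ∸ d) (length D) embed
      (subst (λ e → x ∈ T E e) (sym (m∸n+n≡m d≤j)) x∈T) j-d<D (≤-reflexive (+-identityʳ _))
      (λ i i<k → inj₂ (i , i<k , sym (+-identityʳ i)))
    -- `x` lies past the range of `D`, and `j ≤ suc (i + d)` with `i < length D` leaves only the
    -- layer directly after it.
    ...   | inj₂ D≤j-d = extend-window x∉D 0 d (length D) (suc (length D)) embed
      (subst (λ e → x ∈ T E e) (trans (sym (m∸n+n≡m d≤j)) (cong (_+ d) j-d≡D)) x∈T)
      ≤-refl (≤-trans (≤-reflexive (+-identityʳ _)) (n≤1+n _))
      (λ i i≤D → case m≤n⇒m<n∨m≡n (s≤s⁻¹ i≤D) of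
        λ { (inj₁ i<D) → inj₂ (i , i<D , sym (+-identityʳ i)) ; (inj₂ i≡D) → inj₁ i≡D })
      where
      j-d≡D : j ∸ d ≡ length D
      j-d≡D = ≤-antisym (+-cancelʳ-≤ d _ _ (≤-trans (≤-reflexive (m∸n+n≡m d≤j))
                (≤-trans j≤ (+-monoˡ-≤ d i<k)))) D≤j-d

  -- Variables without neighbours in `Vars D`.

  module _ {D : Layers n} (pld : PLD G D) {x : Fin n} (x∉D : x ∉ Vars D)
           (isolated : ∀ {y} → y ∈ Vars D → ¬ (Arrow G y x ⊎ Arrow G x y)) where
    private
      module D = IsLayerDecomposition (PLD⇒induced pld)

    module Place (q : Subset n) (q⊆x : q ⊆ ⁅ x ⁆) where

      W : Subset n
      W = Vars D ∪ ⁅ x ⁆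

      -- Reading the first layer through `T D 0` and `S D 0`, and the rest through `drop 1 D`, also
      -- covers an empty `D`, which then receives one layer. The set `q` will be `⁅ x ⁆` or `⊥`: it
      -- decides whether `x` joins S⁰.
      place : Layers n
      place = (T D 0 ∪ ⁅ x ⁆ , S D 0 ∪ q) ∷ drop 1 D

      T⁺ : ∀ i {y} → y ∈ T D i → y ∈ T place i
      T⁺ zero    = p⊆p∪q ⁅ x ⁆
      T⁺ (suc i) = subst (λ l → _ ∈ proj₁ l) (sym (layer-drop D i))

      S⁺ : ∀ i {y} → y ∈ S D i → y ∈ S place i
      S⁺ zero    = p⊆p∪q q
      S⁺ (suc i) = subst (λ l → _ ∈ proj₂ l) (sym (layer-drop D i))

      T⁻ : ∀ i {y} → y ∈ T place i → y ∈ T D i ⊎ (y ≡ x × i ≡ 0)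
      T⁻ (suc i) y∈T = inj₁ (subst (λ l → _ ∈ proj₁ l) (layer-drop D i) y∈T)
      T⁻ zero    y∈T with x∈p∪q⁻ _ ⁅ x ⁆ y∈T
      ... | inj₁ y∈T₀ = inj₁ y∈T₀
      ... | inj₂ y∈x  = inj₂ (x∈⁅y⁆⇒x≡y x y∈x , refl)

      S⁻ : ∀ i {y} → y ∈ S place i → y ∈ S D i ⊎ y ≡ x
      S⁻ (suc i) y∈S = inj₁ (subst (λ l → _ ∈ proj₂ l) (layer-drop D i) y∈S)
      S⁻ zero    y∈S with x∈p∪q⁻ _ q y∈S
      ... | inj₁ y∈S₀ = inj₁ y∈S₀
      ... | inj₂ y∈q  = inj₂ (x∈⁅y⁆⇒x≡y x (q⊆x y∈q))

      old : ∀ {y} → y ∈ Vars D → y ≢ x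
      old y∈D refl = x∉D y∈D

      T-old : ∀ i {y} → y ∈ Vars D → y ∈ T place i → y ∈ T D i
      T-old i y∈D y∈T = [ (λ y∈ → y∈) , (λ (y≡x , _) → contradiction y≡x (old y∈D)) ]′ (T⁻ i y∈T)

      S-old : ∀ i {y} → y ∈ Vars D → y ∈ S place i → y ∈ S D i
      S-old i y∈D y∈S = [ (λ y∈ → y∈) , (λ y≡x → contradiction y≡x (old y∈D)) ]′ (S⁻ i y∈S)

      T─S⁺ : ∀ i {y} → y ∈ T D i ─ S D i → y ∈ T place i ─ S place i
      T─S⁺ i y∈ with y∈T ← p─q⊆p (T D i) _ y∈ = x∈p∧x∉q⇒x∈p─q (T⁺ i y∈T)
        (λ y∈S → x∈p─q⇒x∉q (T D i) _ y∈ (S-old i (∈Vars⁺ D i y∈T) y∈S))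

      T─S-old : ∀ i {y} → y ∈ Vars D → y ∈ T place i ─ S place i → y ∈ T D i ─ S D i
      T─S-old i y∈D y∈ = x∈p∧x∉q⇒x∈p─q (T-old i y∈D (p─q⊆p (T place i) _ y∈))
        (λ y∈S → x∈p─q⇒x∉q (T place i) _ y∈ (S⁺ i y∈S))

      -- `x` has no neighbour in `Vars D`, and acyclicity excludes a loop at `x`, so no arrow within
      -- `W` touches `x`. Conditions (D3) to (D5) are thereby inherited from `D`.
      arrow-old : ∀ {y z} → (Arrow G ↾ W) y z → (Arrow G ↾ Vars D) y z
      arrow-old (y∈W , z∈W , a) with x∈p∪q⁻ (Vars D) _ y∈W | x∈p∪q⁻ (Vars D) _ z∈W
      ... | inj₁ y∈D | inj₁ z∈D = y∈D , z∈D , a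
      ... | inj₁ y∈D | inj₂ z∈x rewrite x∈⁅y⁆⇒x≡y x z∈x = contradiction (inj₁ a) (isolated y∈D)
      ... | inj₂ y∈x | inj₁ z∈D rewrite x∈⁅y⁆⇒x≡y x y∈x = contradiction (inj₂ a) (isolated z∈D)
      ... | inj₂ y∈x | inj₂ z∈x rewrite x∈⁅y⁆⇒x≡y x y∈x | x∈⁅y⁆⇒x≡y x z∈x =
        contradiction [ a ] (acyclic G x)

      Vars-place : Vars place ≡ W
      Vars-place = ⊆-antisym to from
        where
        to : Vars place ⊆ W
        to y∈V with i , y∈T ← ∈Vars⁻ place y∈V with T⁻ i y∈T
        ... | inj₁ y∈T₀       = p⊆p∪q ⁅ x ⁆ (∈Vars⁺ D i y∈T₀)
        ... | inj₂ (refl , _) = q⊆p∪q (Vars D) ⁅ x ⁆ (x∈⁅x⁆ x)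
        from : W ⊆ Vars place
        from y∈W with x∈p∪q⁻ (Vars D) _ y∈W
        ... | inj₁ y∈D with i , y∈T ← ∈Vars⁻ D y∈D = ∈Vars⁺ place i (T⁺ i y∈T)
        ... | inj₂ y∈x = ∈Vars⁺ place 0 (q⊆p∪q (T D 0) ⁅ x ⁆ y∈x)

      place-isLayerDecomposition : IsLayerDecomposition W (Arrow G ↾ W) place
      place-isLayerDecomposition = record
        { D1-nonempty = λ
          { zero    _  → x , q⊆p∪q (T D 0) ⁅ x ⁆ (x∈⁅x⁆ x)
          ; (suc i) lt → map₂ (T⁺ (suc i)) (D.D1-nonempty (suc i) (suc<length D lt)) }
        ; D1-disjoint = λ i j i≢j (y , y∈) → let y∈Ti , y∈Tj = x∈p∩q⁻ (T place i) _ y∈ in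
            case T⁻ i y∈Ti of λ
            { (inj₁ y∈T) → i≢j (same-layer (PLD⇒induced pld) y∈T (T-old j (∈Vars⁺ D i y∈T) y∈Tj))
            ; (inj₂ (y≡x , i≡0)) → case T⁻ j y∈Tj of λ
              { (inj₁ y∈T)       → old (∈Vars⁺ D j y∈T) y≡x
              ; (inj₂ (_ , j≡0)) → i≢j (trans i≡0 (sym j≡0)) } }
        ; D1-covers = Vars-place
        ; D2 = λ
          { zero    y∈S → [ T⁺ 0 ∘ D.D2 0 , (λ { refl → q⊆p∪q (T D 0) ⁅ x ⁆ (x∈⁅x⁆ x) }) ]′ (S⁻ 0 y∈S)
          ; (suc i) y∈S → T⁺ (suc i) (D.D2 (suc i) (subst (λ l → _ ∈ proj₂ l) (layer-drop D i) y∈S)) }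
        ; D3 = λ i y z y∈ z∈ →
            (λ a → let y∈D , z∈D , _ = arrow-old a in
              proj₁ (D.D3 i y z (before y∈D y∈) (after z∈D z∈)) (arrow-old a)) ,
            (λ a → let z∈D , y∈D , _ = arrow-old a in
              proj₂ (D.D3 i y z (before y∈D y∈) (after z∈D z∈)) (arrow-old a))
        ; D4-suc = λ i y z y∈S a → let y∈D , _ , _ = arrow-old a in
            x∈p∪q⁺ (case x∈p∪q⁻ _ _ (D.D4-suc i y z (S-old (suc i) y∈D y∈S) (arrow-old a)) of λ
              { (inj₁ z∈T─S) → inj₁ (T─S⁺ (suc i) z∈T─S) ; (inj₂ z∈S) → inj₂ (S⁺ i z∈S) })
        ; D4-zero = λ y z y∈S a → let y∈D , _ , _ = arrow-old a in
            T─S⁺ 0 (D.D4-zero y z (S-old 0 y∈D y∈S) (arrow-old a))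
        ; D5-inner = λ i lt y z z∈S a → let _ , z∈D , _ = arrow-old a in
            T⁺ (suc i) (D.D5-inner i (suc<length D lt) y z (S-old i z∈D z∈S) (arrow-old a))
        -- `place` is longer than `D` only when `D` is empty; the member `z` of `S D i` excludes
        -- this, so both lists end at the same index.
        ; D5-last = λ i i+1≡k y z z∈S a → let z∈S = S-old i (proj₁ (proj₂ (arrow-old a))) z∈S in
            D.D5-last i (trans i+1≡k (length-drop D (∈S⇒< D i z∈S))) y z z∈S (arrow-old a)
        }
        where
        before : ∀ {i y} → y ∈ Vars D →
          (∃ λ j → j < i × y ∈ T place j) ⊎ y ∈ T place i ─ S place i →
          (∃ λ j → j < i × y ∈ T D j) ⊎ y ∈ T D i ─ S D i
        before y∈D (inj₁ (j , j<i , y∈T)) = inj₁ (j , j<i , T-old j y∈D y∈T)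
        before {i} y∈D (inj₂ y∈T─S)       = inj₂ (T─S-old i y∈D y∈T─S)
        after : ∀ {i z} → z ∈ Vars D → (∃ λ j → i < j × z ∈ T place j) → ∃ λ j → i < j × z ∈ T D j
        after z∈D (j , i<j , z∈T) = j , i<j , T-old j z∈D z∈T

      place-insertion : Insertion G x D place
      place-insertion = record
        { fresh = x∉D
        ; pld   = W , place-isLayerDecomposition
        ; vars  = Vars-place
        ; sub   = (λ y∈D → subst (_ ∈_) (sym Vars-place) (p⊆p∪q ⁅ x ⁆ y∈D)) , 0 , λ i _ →
            subst (λ j → T D i ⊆ T place j × S D i ⊆ S place j × (T D i ─ S D i) ⊆ (T place j ─ S place j))
              (sym (+-identityʳ i)) (T⁺ i , S⁺ i , T─S⁺ i)
        }

    -- The two placements are told apart by `x` in their S⁰: equality would put `x` into `S D 0` or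
    -- into `⊥`.
    isolated⇒ManyInsertions : ManyInsertions G x D
    isolated⇒ManyInsertions = P.place , Q.place , P.place-insertion , Q.place-insertion , λ eq →
      [ (λ x∈S → x∉D (∈Vars⁺ D 0 (D.D2 0 x∈S))) , ∉⊥ ]′
        (x∈p∪q⁻ (S D 0) ⊥ (subst (λ D′ → x ∈ S D′ 0) eq (q⊆p∪q (S D 0) ⁅ x ⁆ (x∈⁅x⁆ x))))
      where
      module P = Place ⁅ x ⁆ (λ y∈ → y∈)
      module Q = Place ⊥ ⊥⊆

  -- Correctness of every run.

  boundary? : ∀ W x → Dec (Boundary G W x)
  boundary? W x = ¬? (x ∈? W) ×-dec any? λ y → (y ∈? W) ×-dec (arrow? G y x ⊎-dec arrow? G x y)

  module _ {D E : Layers n} (pld : PLD G D) (ld : LayerDecomposition G E) (D⊑E : D ⊑ E) where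

    ¬blocked : ¬ Blocked G D
    ¬blocked (x , x∉D , none) with boundary? (Vars D) x
    ... | yes bd with D′ , ins , _ ← extend-boundary pld ld D⊑E x bd = none D′ ins
    ... | no ¬bd with D′ , _ , ins , _ ← isolated⇒ManyInsertions pld x∉D
                                            (λ y∈D adj → ¬bd (x∉D , _ , y∈D , adj)) = none D′ ins

    -- For a boundary variable, uniqueness identifies the forced insertion with the one cut out of
    -- `E`. Any other variable has two distinct insertions, so it cannot be forced.
    forced-⊑ : ∀ {x D′} → UniqueInsertion G x D D′ → D′ ⊑ E
    forced-⊑ {x} (ins , unique) with boundary? (Vars D) x
    ... | yes bd with D″ , ins″ , D″⊑E ← extend-boundary pld ld D⊑E x bd =
      subst (_⊑ E) (unique D″ ins″) D″⊑E
    ... | no ¬bd with D₁ , D₂ , ins₁ , ins₂ , D₁≢D₂ ← isolated⇒ManyInsertions pld (Insertion.fresh ins)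
                        (λ y∈D adj → ¬bd (Insertion.fresh ins , _ , y∈D , adj)) =
      contradiction (trans (unique D₁ ins₁) (sym (unique D₂ ins₂))) D₁≢D₂

    extend-candidate : ∀ {x} → Candidate G D x → ExtendsTo D x E
    extend-candidate (inj₁ empty)    = extend-⊥ pld ld empty _
    extend-candidate (inj₂ (_ , bd)) = extend-boundary pld ld D⊑E _ bd

  resolution-PLD : ∀ {D D₁} → PLD G D → Resolution G D (just D₁) → PLD G D₁
  resolution-PLD pld (forced (_ , _ , ins , _) res) = resolution-PLD (Insertion.pld ins) res
  resolution-PLD pld (settled _)                    = pld

  resolution-⊑ : ∀ {D E r} → PLD G D → LayerDecomposition G E → D ⊑ E → Resolution G D r →
                 ∃ λ D₁ → r ≡ just D₁ × D₁ ⊑ E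
  resolution-⊑ pld ld D⊑E (blocked b) = contradiction b (¬blocked pld ld D⊑E)
  resolution-⊑ pld ld D⊑E (forced (_ , _ , unique) res) =
    resolution-⊑ (Insertion.pld (proj₁ unique)) ld (forced-⊑ pld ld D⊑E unique) res
  resolution-⊑ pld ld D⊑E (settled _) = _ , refl , D⊑E

  -- The value is a variable `r` with an equation because recursive values have the form `F Dᵢ`,
  -- which is no constructor pattern.
  basicLD-sound : ∀ {D r E} → PLD G D → BasicLD G D r → r ≡ just E → LayerDecomposition G E
  basicLD-sound pld (complete res full) refl = PLD-full (resolution-PLD pld res) full
  basicLD-sound pld (best _ _ _ _ run ins eq _) refl =
    basicLD-sound (Insertion.pld ins) (run _ ins) eq

  -- Induction on the run, along the branch whose PLD stays below `E`. The conclusion bounds the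
  -- width instead of claiming `D′ ⊑ E`, since `best` may return the value of another branch.
  basicLD-optimal : ∀ {D r E} → PLD G D → LayerDecomposition G E → D ⊑ E → BasicLD G D r →
                    ∃ λ D′ → r ≡ just D′ × width D′ ≤ width E
  basicLD-optimal pld ld D⊑E (unresolvable res)
    with _ , () , _ ← resolution-⊑ pld ld D⊑E res
  basicLD-optimal {E = E} pld ld D⊑E (complete {D₁} res full)
    with D₁ , refl , D₁⊑E ← resolution-⊑ pld ld D⊑E res = D₁ , refl , ⊑⇒width≤ D₁ E D₁⊑E
  basicLD-optimal pld ld D⊑E (all-nil F res _ cand run nil)
    with D₁ , refl , D₁⊑E ← resolution-⊑ pld ld D⊑E res
    with D′ , ins , D′⊑E ← extend-candidate (resolution-PLD pld res) ld D₁⊑E cand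
    with _ , eq , _ ← basicLD-optimal (Insertion.pld ins) ld D′⊑E (run D′ ins)
    -- The branch below `E` has a value, so the branches are not all nil.
    with () ← trans (sym eq) (nil D′ ins)
  basicLD-optimal pld ld D⊑E (best F res _ cand run _ _ least)
    with D₁ , refl , D₁⊑E ← resolution-⊑ pld ld D⊑E res
    with D′ , ins , D′⊑E ← extend-candidate (resolution-PLD pld res) ld D₁⊑E cand
    with _ , eq , E′≤E ← basicLD-optimal (Insertion.pld ins) ld D′⊑E (run D′ ins) =
    _ , refl , ≤-trans (least D′ _ ins eq) E′≤E

  -- Search for insertions, progress of resolution, choice of a narrowest value.

  PLD? : Decidable (PLD G)
  PLD? D = map′ (λ ld → Vars D , ld) PLD⇒induced
    (isLayerDecomposition? (Vars D) (λ x y → (x ∈? Vars D) ×-dec (y ∈? Vars D) ×-dec arrow? G x y) D)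

  insertion? : ∀ x D D′ → Dec (Insertion G x D D′)
  insertion? x D D′ = map′
    (λ { (fresh , pld , vars , sub) → record { fresh = fresh ; pld = pld ; vars = vars ; sub = sub } })
    (λ ins → let open Insertion ins in fresh , pld , vars , sub)
    (¬? (x ∈? Vars D) ×-dec PLD? D′ ×-dec (Vars D′ ≟ˢ (Vars D ∪ ⁅ x ⁆)) ×-dec (D ⊑? D′))

  -- An insertion is a PLD and so has at most `n` layers, which bounds the search.
  any-insertion? : ∀ x D {P : Pred (Layers n) 0ℓ} → Decidable P → Dec (∃ λ D′ → Insertion G x D D′ × P D′)
  any-insertion? x D P? = any-Layers? n (λ D′ → insertion? x D D′ ×-dec P? D′)
    (λ (ins , _) → length≤n (proj₂ (Insertion.pld ins)))

  insertion-⊂ : ∀ {x D D′} → Insertion G x D D′ → Vars D ⊂ Vars D′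
  insertion-⊂ {x} {D} ins rewrite Insertion.vars ins =
    p⊆p∪q ⁅ x ⁆ , x , q⊆p∪q (Vars D) ⁅ x ⁆ (x∈⁅x⁆ x) , Insertion.fresh ins

  none-unique-or-many : ∀ x D → NoInsertion G x D ⊎ ∃ (UniqueInsertion G x D) ⊎ ManyInsertions G x D
  none-unique-or-many x D with any-insertion? x D (λ _ → yes tt)
  ... | no none = inj₁ λ D′ ins → none (D′ , ins , tt)
  ... | yes (D′ , ins , _) with any-insertion? x D (λ D″ → ¬? (D″ ≟ˡ D′))
  ...   | no only = inj₂ (inj₁ (D′ , ins , λ D″ ins″ →
            decidable-stable (D″ ≟ˡ D′) λ D″≢D′ → only (D″ , ins″ , D″≢D′)))
  ...   | yes (D″ , ins″ , D″≢D′) = inj₂ (inj₂ (D″ , D′ , ins″ , ins , D″≢D′))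

  -- A forced step presupposes that no variable is blocked. Hence two passes: blocked variables are
  -- sought first, and only then variables with a unique insertion.
  resolution-progress : ∀ D → Blocked G D ⊎ Settled G D ⊎ ∃ (ForcedStep G D)
  resolution-progress D with Fin-search {A = Stuck} {B = Placeable} classify
    where
    Stuck Placeable : Fin n → Set
    Stuck x     = x ∉ Vars D × NoInsertion G x D
    Placeable x = x ∉ Vars D → ∃ (UniqueInsertion G x D) ⊎ ManyInsertions G x D
    classify : ∀ x → Stuck x ⊎ Placeable x
    classify x with x ∈? Vars D | none-unique-or-many x D
    ... | yes x∈D | _         = inj₂ λ x∉D → contradiction x∈D x∉D
    ... | no  x∉D | inj₁ none = inj₁ (x∉D , none)
    ... | no  _   | inj₂ some = inj₂ λ _ → some
  ... | inj₁ stuck     = inj₁ stuck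
  ... | inj₂ placeable with Fin-search {A = Forced} {B = Free} classify
    where
    Forced Free : Fin n → Set
    Forced x = ∃ (UniqueInsertion G x D)
    Free x   = x ∉ Vars D → ManyInsertions G x D
    classify : ∀ x → Forced x ⊎ Free x
    classify x with x ∈? Vars D
    ... | yes x∈D = inj₂ λ x∉D → contradiction x∈D x∉D
    ... | no  x∉D with placeable x x∉D
    ...   | inj₁ unique = inj₁ unique
    ...   | inj₂ many   = inj₂ λ _ → many
  ...   | inj₂ many             = inj₂ (inj₁ many)
  ...   | inj₁ (x , D′ , unique) = inj₂ (inj₂ (D′ , unblocked , x , unique))
    where
    unblocked : ¬ Blocked G D
    unblocked (y , y∉D , none) with placeable y y∉D
    ... | inj₁ (D″ , ins , _)     = none D″ ins
    ... | inj₂ (D″ , _ , ins , _) = none D″ ins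

  resolution-terminates : ∀ D → Acc _⊃_ (Vars D) → ResolutionTerminates G D
  resolution-terminates D (acc smaller) = terminates (resolution-progress D)
    λ { D′ (_ , _ , ins , _) → resolution-terminates D′ (smaller (insertion-⊂ ins)) }

  resolution-run : ∀ {D} → ResolutionTerminates G D → ∃ (Resolution G D)
  resolution-run (terminates (inj₁ b) _)                = nothing , blocked b
  resolution-run (terminates (inj₂ (inj₁ s)) _)         = just _ , settled s
  resolution-run (terminates (inj₂ (inj₂ (D′ , f))) next) = map₂ (forced f) (resolution-run (next D′ f))

  resolution-⊆ : ∀ {D D₁} → Resolution G D (just D₁) → Vars D ⊆ Vars D₁
  resolution-⊆ (forced (_ , _ , ins , _) res) = resolution-⊆ res ∘ proj₁ (insertion-⊂ ins)
  resolution-⊆ (settled _)                    = ⊆-refl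

  -- `BasicLD` asks for one total function `F`, while runs are available on insertions only;
  -- deciding `P` supplies the default `nothing` elsewhere. The value at `D` uses the proof found by
  -- `P?`, so it does not vary with the proof of `P D`.
  collect : ∀ {P : Pred (Layers n) 0ℓ} {R : Layers n → Maybe (Layers n) → Set} → Decidable P →
           (∀ D → P D → ∃ (R D)) → ∃ λ F → ∀ D → P D → R D (F D)
  collect {P} {R} P? f = F , spec
    where
    F : Layers n → Maybe (Layers n)
    F D with P? D
    ... | yes p = proj₁ (f D p)
    ... | no _  = nothing
    spec : ∀ D → P D → R D (F D)
    spec D p with P? D
    ... | yes p′ = proj₂ (f D p′)
    ... | no ¬p  = contradiction p ¬p

  module _ (x : Fin n) (D : Layers n) (F : Layers n → Maybe (Layers n)) where

    -- Descent on the width: the current value is replaced by a strictly narrower one until the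
    -- search finds none.
    narrowest : ∀ D′ E → Insertion G x D D′ → F D′ ≡ just E → Acc _<_ (width E) →
      ∃₂ λ D⋆ E⋆ → Insertion G x D D⋆ × F D⋆ ≡ just E⋆ ×
        (∀ Dᵢ Eᵢ → Insertion G x D Dᵢ → F Dᵢ ≡ just Eᵢ → width E⋆ ≤ width Eᵢ)
    narrowest D′ E ins eq (acc smaller)
      with any-insertion? x D (λ D″ → any-just? (λ E′ → width E′ <? width E) (F D″))
    ... | yes (D″ , ins″ , E″ , eq″ , lt) = narrowest D″ E″ ins″ eq″ (smaller lt)
    ... | no none = D′ , E , ins , eq , λ Dᵢ Eᵢ insᵢ eqᵢ →
      ≮⇒≥ λ lt → none (Dᵢ , insᵢ , Eᵢ , eqᵢ , lt)

  combine : ∀ {D D₁ x} (F : Layers n → Maybe (Layers n)) →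
    Resolution G D (just D₁) → Vars D₁ ≢ ⊤ → Candidate G D₁ x →
    (∀ Dᵢ → Insertion G x D₁ Dᵢ → BasicLD G Dᵢ (F Dᵢ)) → ∃ (BasicLD G D)
  combine {D₁ = D₁} {x} F res ¬full cand run
    with any-insertion? x D₁ (λ D′ → any-just? (λ _ → yes tt) (F D′))
  ... | yes (D′ , ins , E , eq , _)
    with _ , E⋆ , ins⋆ , eq⋆ , least ← narrowest x D₁ F D′ E ins eq (<-wellFounded _) =
    just E⋆ , best F res ¬full cand run ins⋆ eq⋆ least
  ... | no none = nothing , all-nil F res ¬full cand run nil
    where
    nil : ∀ Dᵢ → Insertion G x D₁ Dᵢ → F Dᵢ ≡ nothing
    nil Dᵢ ins with F Dᵢ in eq
    ... | nothing = refl
    ... | just E  = contradiction (Dᵢ , ins , E , eq , tt) none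

  -- Candidates from connectedness; termination and existence of runs.

  module _ (connected : Connected G) where

    -- The first step of the path that leaves `W` ends in a boundary variable, whatever the
    -- direction of its arrow.
    crossing : ∀ {W x y} → x ∈ W → y ∉ W → EqClosure (Arrow G) x y → ∃ (Boundary G W)
    crossing x∈W y∉W ε = contradiction x∈W y∉W
    crossing {W} {x} x∈W y∉W (_◅_ {j = z} step path) with z ∈? W
    ... | yes z∈W = crossing z∈W y∉W path
    ... | no  z∉W with step
    ...   | fwd a = z , z∉W , x , x∈W , inj₁ a
    ...   | bwd a = z , z∉W , x , x∈W , inj₂ a

    -- Connectedness enters here: when `Vars D` is nonempty and proper, a path joins one of its
    -- members to a variable outside.
    candidate : ∀ D → Vars D ≢ ⊤ → ∃ (Candidate G D)
    candidate D ¬full with any? (λ x → ¬? (x ∈? Vars D))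
    ... | no all∈ = contradiction
      (⊆-antisym ⊆⊤ λ {x} _ → decidable-stable (x ∈? Vars D) (λ x∉D → all∈ (x , x∉D))) ¬full
    ... | yes (y , y∉D) with nonempty? (Vars D)
    ...   | no empty = y , inj₁ (Empty-unique empty)
    ...   | yes (x , x∈D) = map₂ (λ bd → inj₂ ((λ eq → ∉⊥ (subst (x ∈_) eq x∈D)) , bd))
                                 (crossing x∈D y∉D (connected x y))

    after-insertion : ∀ {D D₁ x Dᵢ} → Resolution G D (just D₁) → Insertion G x D₁ Dᵢ → Vars Dᵢ ⊃ Vars D
    after-insertion res ins = ⊆-⊂-trans (resolution-⊆ res) (insertion-⊂ ins)

    -- Every recursive call has strictly more variables: resolution removes none and the insertion
    -- adds one.
    basicLD-terminates : ∀ D → Acc _⊃_ (Vars D) → BasicLDTerminates G D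
    basicLD-terminates D (acc smaller) = terminates (resolution-terminates D (⊃-wellFounded _))
      λ D₁ res ¬full → candidate D₁ ¬full , λ _ Dᵢ _ ins →
        basicLD-terminates Dᵢ (smaller (after-insertion res ins))

    basicLD-run : ∀ D → Acc _⊃_ (Vars D) → ∃ (BasicLD G D)
    basicLD-run D (acc smaller) with resolution-run (resolution-terminates D (⊃-wellFounded _))
    ... | nothing , res = nothing , unresolvable res
    ... | just D₁ , res with Vars D₁ ≟ˢ ⊤
    ...   | yes full = just D₁ , complete res full
    ...   | no ¬full with x , cand ← candidate D₁ ¬full
                     with F , run ← collect (insertion? x D₁) (λ Dᵢ ins →
                                      basicLD-run Dᵢ (smaller (after-insertion res ins))) =
      combine F res ¬full cand run

-- Existence of a layer decomposition, and the theorem.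

trivial-decomposition : ∀ {n} (G : DAG n) → ∃ (LayerDecomposition G)
-- Without variables the single block `⊤` would be empty, against (D1); the empty list serves
-- instead.
trivial-decomposition {zero}  G = [] , PLD-full G (PLD-∅ G) refl
trivial-decomposition {suc n} G = (⊤ , ⊥) ∷ [] , record
  { D1-nonempty = λ { zero _ → zero , ∈⊤ ; (suc _) (s≤s ()) }
  ; D1-disjoint = λ
    { zero    zero    i≢j _        → i≢j refl
    ; zero    (suc _) _   (_ , x∈) → ∉⊥ (proj₂ (x∈p∩q⁻ ⊤ ⊥ x∈))
    ; (suc _) j       _   (_ , x∈) → ∉⊥ (proj₁ (x∈p∩q⁻ ⊥ (T ((⊤ , ⊥) ∷ []) j) x∈)) }
  ; D1-covers   = ∪-identityʳ ⊤
  ; D2          = λ { zero → ⊥⊆ ; (suc _) x∈ → x∈ }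
  ; D3          = λ { _ _ _ _ (zero , () , _) ; _ _ _ _ (suc _ , _ , y∈) → contradiction y∈ ∉⊥ }
  ; D4-suc      = λ _ _ _ x∈ → contradiction x∈ ∉⊥
  ; D4-zero     = λ _ _ x∈ → contradiction x∈ ∉⊥
  ; D5-inner    = λ { _ (s≤s ()) }
  ; D5-last     = λ { zero _ _ _ y∈ → contradiction y∈ ∉⊥ ; (suc _) _ _ _ y∈ → contradiction y∈ ∉⊥ }
  }

theorem5 : ∀ (n : ℕ) (G : DAG n) → Connected G →
    BasicLDTerminates G [] ×
    ∃ (BasicLD G []) ×
    (∀ r → BasicLD G [] r → ∃ λ D → r ≡ just D × Optimal G D)
theorem5 n G connected =
    basicLD-terminates G connected [] (⊃-wellFounded _)
  , basicLD-run G connected [] (⊃-wellFounded _)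
  -- Comparison with the trivial decomposition shows that `r` is not nil; comparison with each `E`
  -- then gives minimality.
  , λ r run → case below run (trivial-decomposition G) of λ { (D , refl , _) →
      D , refl , basicLD-sound G (PLD-∅ G) run refl , λ E ld →
        case below run (E , ld) of λ { (_ , refl , le) → le } }
  where
  below : ∀ {r} → BasicLD G [] r → (E,ld : ∃ (LayerDecomposition G)) →
          ∃ λ D → r ≡ just D × width D ≤ width (proj₁ E,ld)
  below run (E , ld) = basicLD-optimal G (PLD-∅ G) ld (∅⊑ E) run
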